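{- Let $M=\langle W,W^\bot,\preceq,R,V\rangle$ be a $\mathsf{CK}$-model, $w\in W$, and $\varphi$ a well-named $\mu$-sentence. Then exactly one of the players $\mathsf I$ and $\mathsf{II}$ has a positional winning strategy in the evaluation game $\mathcal G(M,w\models\varphi)$.
   Context: Syntax. $\mu$-formulas over disjoint sets $\mathrm{Prop}$, $\mathrm{Var}$: $\varphi ::= P \mid X \mid \bot \mid \varphi\land\varphi \mid \varphi\lor\varphi \mid \varphi\to\varphi \mid \Box\varphi \mid \Diamond\varphi \mid \mu X.\varphi \mid \nu X.\varphi$, where $\eta X.\varphi$ ($\eta\in\{\mu,\nu\}$) requires $X$ positive in $\varphi$ (every free occurrence of $X$ lies in the antecedent of an even number of implications). A sentence has no free variables. $\varphi$ is well-named if it is guarded (for every subformula $\eta X.\psi$, each occurrence of $X$ in $\psi$ is in the scope of $\Box$ or $\Diamond$) and each bound variable $X$ is bound by only one fixed-point operator $\eta X$ in $\varphi$; then $\psi_X$ denotes the body of that unique subformula $\eta X.\psi_X$. $\mathrm{Sub}(\varphi)$ is the set of subformulas. $\mathsf{CK}$-model: $W\neq\emptyset$, $W^\bot\subseteq W$, $\preceq$ a preorder, $R\subseteq W^2$, $V:\mathrm{Prop}\to\mathcal P(W)$ with each $V(P)$ $\preceq$-upward closed and containing $W^\bot$, and $W^\bot$ closed under $\preceq$ and $R$. Game $\mathcal G(M,w\models\varphi)$. Two players $\mathsf I,\mathsf{II}$; roles Verifier ($\mathsf V$) and Refuter ($\mathsf R$); $\bar{\mathsf Q}$ is the role dual to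 $\mathsf Q$. Positions: $\langle v,\psi,\mathsf Q\rangle$ with $v\in W$, $\psi\in\mathrm{Sub}(\varphi)$; auxiliary $\langle v,\hat\Diamond\psi,\mathsf Q\rangle$ for $\Diamond\psi\in\mathrm{Sub}(\varphi)$ and $\langle v,\psi?\theta,\mathsf Q\rangle$ for $\psi\to\theta\in\mathrm{Sub}(\varphi)$; $\mathsf Q$ is $\mathsf I$'s current role and $\mathsf{II}$ has $\bar{\mathsf Q}$. Each position is assigned to a role and is owned by the player currently holding that role; the owner chooses among the admissible moves. Positions of role $\mathsf V$: $\langle v,P,\mathsf Q\rangle$ with $v\notin V(P)$ (no moves); $\langle v,\bot,\mathsf Q\rangle$ with $v\notin W^\bot$ (no moves); $\langle v,\psi\lor\theta,\mathsf Q\rangle\to\langle v,\psi,\mathsf Q\rangle$ or $\langle v,\theta,\mathsf Q\rangle$; $\langle v,\psi?\theta,\mathsf Q\rangle\to\langle v,\psi,\bar{\mathsf Q}\rangle$ or $\langle v,\theta,\mathsf Q\rangle$; $\langle v,\hat\Diamond\psi,\mathsf Q\rangle\to\langle u,\psi,\mathsf Q\rangle$ with $vRu$; $\langle v,\mu X.\psi_X,\mathsf Q\rangle\to\langle v,\psi_X,\mathsf Q\rangle$; $\langle v,X,\mathsf Q\rangle\to\langle v,\mu X.\psi_X,\mathsf Q\rangle$ ($X$ bound by $\mu$). Positions of role $\mathsf R$: $\langle v,P,\mathsf Q\rangle$ with $v\in V(P)$ (no moves); $\langle v,\bot,\mathsf Q\rangle$ with $v\in W^\bot$ (no moves); $\langle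 v,\psi\land\theta,\mathsf Q\rangle\to\langle v,\psi,\mathsf Q\rangle$ or $\langle v,\theta,\mathsf Q\rangle$; $\langle v,\psi\to\theta,\mathsf Q\rangle\to\langle u,\psi?\theta,\mathsf Q\rangle$ with $v\preceq u$; $\langle v,\Box\psi,\mathsf Q\rangle\to\langle u,\psi,\mathsf Q\rangle$ with $v\preceq v'Ru$ for some $v'$; $\langle v,\Diamond\psi,\mathsf Q\rangle\to\langle u,\hat\Diamond\psi,\mathsf Q\rangle$ with $v\preceq u$; $\langle v,\nu X.\psi_X,\mathsf Q\rangle\to\langle v,\psi_X,\mathsf Q\rangle$; $\langle v,X,\mathsf Q\rangle\to\langle v,\nu X.\psi_X,\mathsf Q\rangle$ ($X$ bound by $\nu$). The game starts at $\langle w,\varphi,\mathsf V\rangle$. A run is a sequence of positions from the start, each an admissible move from the previous, either infinite or ending at a position with no admissible move; in the latter case the owner of the last position loses. A move $\langle v,X,\mathsf Q\rangle\to\langle v,\eta X.\psi_X,\mathsf Q\rangle$ regenerates $\eta X.\psi_X$. The fixed-point formula $\eta X.\psi_X$ is owned by $\mathsf I$ if some position $\langle v,\eta X.\psi_X,\mathsf Q\rangle$ is reachable from the start with ($\mathsf Q=\mathsf V$ and $\eta=\nu$) or ($\mathsf Q=\mathsf R$ and $\eta=\mu$), and owned by $\mathsf{II}$ otherwise. An infinite run is won by $\mathsf I$ iff $\mathsf I$ owns the outermost fixed-point formula regenerated infinitely often (the one having all other infinitely often regenerated fixed-point formulas as subformulas). A positional strategy for a player maps each position owned by that player having an admissible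 move to an admissible move; it is winning if the player wins every run in which they follow it. -}

module Defs where

open import Level using (0ℓ)
open import Data.Nat using (ℕ; zero; suc; _≤_)
open import Data.Product using (Σ; ∃; ∃-syntax; _×_; _,_)
open import Data.Sum using (_⊎_)
open import Data.Empty using (⊥)
open import Data.Unit using (⊤)
open import Data.List using (List; []; _∷_; _++_)
open import Data.List.Relation.Unary.Unique.Propositional using (Unique)
open import Relation.Nullary using (¬_)
open import Relation.Binary.PropositionalEquality using (_≡_; _≢_)
open import Relation.Binary.Structures using (IsPreorder)
open import Relation.Binary.Construct.Closure.ReflexiveTransitive using (Star)

-- Syntax of μ-formulas over Prop (propositional letters) and Var
-- (fixed-point variables).  Disjointness of Prop and Var is built in
-- by using separate constructors.

data FP : Set where
  μ ν : FP

data Fm (Prop Var : Set) : Set where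
  prop : Prop → Fm Prop Var
  var  : Var → Fm Prop Var
  ⊥f   : Fm Prop Var
  _∧f_ _∨f_ _⇒f_ : Fm Prop Var → Fm Prop Var → Fm Prop Var
  □f ◇f : Fm Prop Var → Fm Prop Var
  fix  : FP → Var → Fm Prop Var → Fm Prop Var

module _ {Prop Var : Set} where

  data Sub : Fm Prop Var → Fm Prop Var → Set where
    here : ∀ {φ} → Sub φ φ
    ∧l   : ∀ {ψ a b} → Sub ψ a → Sub ψ (a ∧f b)
    ∧r   : ∀ {ψ a b} → Sub ψ b → Sub ψ (a ∧f b)
    ∨l   : ∀ {ψ a b} → Sub ψ a → Sub ψ (a ∨f b)
    ∨r   : ∀ {ψ a b} → Sub ψ b → Sub ψ (a ∨f b)
    ⇒l   : ∀ {ψ a b} → Sub ψ a → Sub ψ (a ⇒f b)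
    ⇒r   : ∀ {ψ a b} → Sub ψ b → Sub ψ (a ⇒f b)
    □s   : ∀ {ψ a} → Sub ψ a → Sub ψ (□f a)
    ◇s   : ∀ {ψ a} → Sub ψ a → Sub ψ (◇f a)
    fixs : ∀ {ψ η X a} → Sub ψ a → Sub ψ (fix η X a)

  data Parity : Set where
    even odd : Parity

  flipP : Parity → Parity
  flipP even = odd
  flipP odd  = even

  data Occ : Parity → Var → Fm Prop Var → Set where
    occ-var : ∀ {X} → Occ even X (var X)
    occ-∧l  : ∀ {p X a b} → Occ p X a → Occ p X (a ∧f b)
    occ-∧r  : ∀ {p X a b} → Occ p X b → Occ p X (a ∧f b)
    occ-∨l  : ∀ {p X a b} → Occ p X a → Occ p X (a ∨f b)
    occ-∨r  : ∀ {p X a b} → Occ p X b → Occ p X (a ∨f b)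
    occ-⇒l  : ∀ {p X a b} → Occ (flipP p) X a → Occ p X (a ⇒f b)
    occ-⇒r  : ∀ {p X a b} → Occ p X b → Occ p X (a ⇒f b)
    occ-□   : ∀ {p X a} → Occ p X a → Occ p X (□f a)
    occ-◇   : ∀ {p X a} → Occ p X a → Occ p X (◇f a)
    occ-fix : ∀ {p X Y η a} → Y ≢ X → Occ p X a → Occ p X (fix η Y a)

  Free : Var → Fm Prop Var → Set
  Free X φ = ∃[ p ] Occ p X φ

  Positive : Var → Fm Prop Var → Set
  Positive X φ = ¬ Occ odd X φ

  IsMuFormula : Fm Prop Var → Set
  IsMuFormula φ = ∀ {η X ψ} → Sub (fix η X ψ) φ → Positive X ψ

  Sentence : Fm Prop Var → Set
  Sentence φ = ∀ X → ¬ Free X φ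

  data Unguarded : Var → Fm Prop Var → Set where
    ug-var : ∀ {X} → Unguarded X (var X)
    ug-∧l  : ∀ {X a b} → Unguarded X a → Unguarded X (a ∧f b)
    ug-∧r  : ∀ {X a b} → Unguarded X b → Unguarded X (a ∧f b)
    ug-∨l  : ∀ {X a b} → Unguarded X a → Unguarded X (a ∨f b)
    ug-∨r  : ∀ {X a b} → Unguarded X b → Unguarded X (a ∨f b)
    ug-⇒l  : ∀ {X a b} → Unguarded X a → Unguarded X (a ⇒f b)
    ug-⇒r  : ∀ {X a b} → Unguarded X b → Unguarded X (a ⇒f b)
    ug-fix : ∀ {X Y η a} → Unguarded X a → Unguarded X (fix η Y a)

  Guarded : Fm Prop Var → Set
  Guarded φ = ∀ {η X ψ} → Sub (fix η X ψ) φ → ¬ Unguarded X ψ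

  binders : Fm Prop Var → List Var
  binders (prop _)  = []
  binders (var _)   = []
  binders ⊥f        = []
  binders (a ∧f b)  = binders a ++ binders b
  binders (a ∨f b)  = binders a ++ binders b
  binders (a ⇒f b)  = binders a ++ binders b
  binders (□f a)    = binders a
  binders (◇f a)    = binders a
  binders (fix _ X a) = X ∷ binders a

  WellNamed : Fm Prop Var → Set
  WellNamed φ = Guarded φ × Unique (binders φ)

record CKModel (Prop : Set) : Set₁ where
  field
    W       : Set
    W⊥      : W → Set
    _≼_     : W → W → Set
    R       : W → W → Set
    V       : Prop → W → Set
    nonempty : W
    ≼-preorder : IsPreorder _≡_ _≼_
    V-up    : ∀ P {v u} → V P v → v ≼ u → V P u
    V-⊥     : ∀ P {v} → W⊥ v → V P v
    W⊥-≼    : ∀ {v u} → W⊥ v → v ≼ u → W⊥ u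
    W⊥-R    : ∀ {v u} → W⊥ v → R v u → W⊥ u

data Role : Set where
  Vr Rr : Role

dual : Role → Role
dual Vr = Rr
dual Rr = Vr

data Player : Set where
  I II : Player

opponent : Player → Player
opponent I  = II
opponent II = I

roleOfPlayer : Player → Role → Role
roleOfPlayer I  Q = Q
roleOfPlayer II Q = dual Q

module Game {Prop Var : Set} (M : CKModel Prop) (φ : Fm Prop Var) where
  open CKModel M

  data Position : Set where
    pos    : W → Fm Prop Var → Role → Position
    ◇pos   : W → Fm Prop Var → Role → Position
    ?pos   : W → Fm Prop Var → Fm Prop Var → Role → Position

  BoundBy : FP → Var → Set
  BoundBy η X = ∃[ ψ ] Sub (fix η X ψ) φ

  data RoleOf : Position → Role → Set where
    r-propV : ∀ {v P Q} → ¬ V P v → RoleOf (pos v (prop P) Q) Vr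
    r-⊥V    : ∀ {v Q} → ¬ W⊥ v → RoleOf (pos v ⊥f Q) Vr
    r-∨     : ∀ {v a b Q} → RoleOf (pos v (a ∨f b) Q) Vr
    r-?     : ∀ {v a b Q} → RoleOf (?pos v a b Q) Vr
    r-◇̂     : ∀ {v a Q} → RoleOf (◇pos v a Q) Vr
    r-μ     : ∀ {v X a Q} → RoleOf (pos v (fix μ X a) Q) Vr
    r-Xμ    : ∀ {v X Q} → BoundBy μ X → RoleOf (pos v (var X) Q) Vr
    r-propR : ∀ {v P Q} → V P v → RoleOf (pos v (prop P) Q) Rr
    r-⊥R    : ∀ {v Q} → W⊥ v → RoleOf (pos v ⊥f Q) Rr
    r-∧     : ∀ {v a b Q} → RoleOf (pos v (a ∧f b) Q) Rr
    r-⇒     : ∀ {v a b Q} → RoleOf (pos v (a ⇒f b) Q) Rr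
    r-□     : ∀ {v a Q} → RoleOf (pos v (□f a) Q) Rr
    r-◇     : ∀ {v a Q} → RoleOf (pos v (◇f a) Q) Rr
    r-ν     : ∀ {v X a Q} → RoleOf (pos v (fix ν X a) Q) Rr
    r-Xν    : ∀ {v X Q} → BoundBy ν X → RoleOf (pos v (var X) Q) Rr

  roleI : Position → Role
  roleI (pos _ _ Q)    = Q
  roleI (◇pos _ _ Q)   = Q
  roleI (?pos _ _ _ Q) = Q

  Owner : Position → Player → Set
  Owner p pl = RoleOf p (roleOfPlayer pl (roleI p))

  data Move : Position → Position → Set where
    m-∨l : ∀ {v a b Q} → Move (pos v (a ∨f b) Q) (pos v a Q)
    m-∨r : ∀ {v a b Q} → Move (pos v (a ∨f b) Q) (pos v b Q)
    m-?l : ∀ {v a b Q} → Move (?pos v a b Q) (pos v a (dual Q))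
    m-?r : ∀ {v a b Q} → Move (?pos v a b Q) (pos v b Q)
    m-◇̂  : ∀ {v u a Q} → R v u → Move (◇pos v a Q) (pos u a Q)
    m-fix : ∀ {v η X a Q} → Move (pos v (fix η X a) Q) (pos v a Q)
    m-X  : ∀ {v η X a Q} → Sub (fix η X a) φ → Move (pos v (var X) Q) (pos v (fix η X a) Q)
    m-∧l : ∀ {v a b Q} → Move (pos v (a ∧f b) Q) (pos v a Q)
    m-∧r : ∀ {v a b Q} → Move (pos v (a ∧f b) Q) (pos v b Q)
    m-⇒  : ∀ {v u a b Q} → v ≼ u → Move (pos v (a ⇒f b) Q) (?pos u a b Q)
    m-□  : ∀ {v v' u a Q} → v ≼ v' → R v' u → Move (pos v (□f a) Q) (pos u a Q)
    m-◇  : ∀ {v u a Q} → v ≼ u → Move (pos v (◇f a) Q) (◇pos u a Q)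

  HasMove : Position → Set
  HasMove p = ∃[ p' ] Move p p'

  module _ (w : W) where
    start : Position
    start = pos w φ Vr

    Reachable : Position → Set
    Reachable = Star Move start

    OwnCond : Fm Prop Var → Role → Set
    OwnCond (fix ν _ _) Vr = ⊤
    OwnCond (fix μ _ _) Rr = ⊤
    OwnCond _ _ = ⊥

    OwnedByI : Fm Prop Var → Set
    OwnedByI F = ∃[ v ] ∃[ Q ] (Reachable (pos v F Q) × OwnCond F Q)

    data Regen : Fm Prop Var → Position → Position → Set where
      regen : ∀ {v η X a Q} → Regen (fix η X a) (pos v (var X) Q) (pos v (fix η X a) Q)

    IsInfiniteRun : (ℕ → Position) → Set
    IsInfiniteRun f = f 0 ≡ start × (∀ n → Move (f n) (f (suc n)))

    IsFiniteRun : (ℕ → Position) → ℕ → Set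
    IsFiniteRun f k = f 0 ≡ start × (∀ n → suc n ≤ k → Move (f n) (f (suc n))) × ¬ HasMove (f k)

    InfOften : Fm Prop Var → (ℕ → Position) → Set
    InfOften F f = ∀ n → ∃[ m ] (n ≤ m × Regen F (f m) (f (suc m)))

    Outermost : Fm Prop Var → (ℕ → Position) → Set
    Outermost F f = InfOften F f × (∀ G → InfOften G f → Sub G F)

    IWinsInfinite : (ℕ → Position) → Set
    IWinsInfinite f = ∃[ F ] (Outermost F f × OwnedByI F)

    WinsInfinite : Player → (ℕ → Position) → Set
    WinsInfinite I  f = IWinsInfinite f
    WinsInfinite II f = ¬ IWinsInfinite f

    WinsFinite : Player → (ℕ → Position) → ℕ → Set
    WinsFinite pl f k = Owner (f k) (opponent pl)

    IsPositionalStrategy : Player → (Position → Position) → Set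
    IsPositionalStrategy pl σ = ∀ p → Owner p pl → HasMove p → Move p (σ p)

    Follows : Player → (Position → Position) → (ℕ → Position) → ℕ → Set
    Follows pl σ f k = ∀ n → suc n ≤ k → Owner (f n) pl → f (suc n) ≡ σ (f n)

    FollowsInf : Player → (Position → Position) → (ℕ → Position) → Set
    FollowsInf pl σ f = ∀ n → Owner (f n) pl → f (suc n) ≡ σ (f n)

    IsWinning : Player → (Position → Position) → Set
    IsWinning pl σ =
      (∀ f k → IsFiniteRun f k → Follows pl σ f k → WinsFinite pl f k) ×
      (∀ f → IsInfiniteRun f → FollowsInf pl σ f → WinsInfinite pl f)

    HasPositionalWinningStrategy : Player → Set
    HasPositionalWinningStrategy pl =
      ∃[ σ ] (IsPositionalStrategy pl σ × IsWinning pl σ)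

ExactlyOneWins : ∀ {Prop Var : Set} (M : CKModel Prop) → CKModel.W M → Fm Prop Var → Set
ExactlyOneWins M w φ =
  (HPWS w I ⊎ HPWS w II) × ¬ (HPWS w I × HPWS w II)
  where open Game M φ using () renaming (HasPositionalWinningStrategy to HPWS)

{-# OPTIONS --safe #-}

-- The evaluation game is a parity game: a position at a variable gets a
-- priority that grows with the size of the fixed-point formula bound there and
-- that encodes its owner.  As φ is a sentence whose binders are distinct, a
-- play can leave the subformulas of a fixed-point formula only by regenerating
-- a larger one, so the greatest priority seen infinitely often belongs to the
-- outermost formula.
-- Positional determinacy: the winning regions are nested fixed points with one
-- level per priority, dual to each other.  A μ-level is a union of approximants
-- indexed by ordinals; from a position of rank α one plays a strategy for the
-- α-th approximant, so ranks never increase and drop at each visit to the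
-- priority of that level, which therefore occurs only finitely often.
module Submission where

open import Defs
open import Level using (0ℓ)
open import Axiom.ExcludedMiddle using (ExcludedMiddle)
open import Data.Bool.Base using (Bool; true; false; T)
open import Data.Nat using (ℕ; zero; suc; _+_; _∸_; _≤_; _<_; z≤n; s≤s; s≤s⁻¹)
open import Data.Nat.Properties
open import Data.List using (List; []; _∷_; _++_)
open import Data.List.Membership.Propositional using (_∈_)
open import Data.List.Membership.Propositional.Properties using (∈-++⁺ˡ; ∈-++⁺ʳ)
open import Data.List.Relation.Unary.All as All using ()
import Data.List.Relation.Unary.All.Properties as All
open import Data.List.Relation.Unary.AllPairs using ([]; _∷_)
open import Data.List.Relation.Unary.Any using (here; there)
open import Data.List.Relation.Unary.Unique.Propositional using (Unique)
open import Data.Nat.Induction using (<-rec)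
open import Data.Product using (∃; _×_; _,_; proj₁; proj₂)
open import Data.Sum using (_⊎_; inj₁; inj₂)
open import Data.Unit using (⊤; tt)
open import Function using (_∘_; case_of_)
open import Induction.WellFounded using (Acc; acc; WellFounded)
open import Relation.Binary.PropositionalEquality
open import Relation.Nullary using (¬_; yes; no; contradiction)
open import Relation.Nullary.Decidable using (decidable-stable)
open import Relation.Unary using (Pred; _⊆_; ∁)

-- Classical logic and tree ordinals

module Classical (em : ExcludedMiddle 0ℓ) where

  ¬∀⇒∃¬ : ∀ {A : Set} {B : A → Set} → ¬ (∀ x → B x) → ∃ λ x → ¬ B x
  ¬∀⇒∃¬ ¬all = decidable-stable em λ ¬ex →
    ¬all λ x → decidable-stable em λ ¬Bx → ¬ex (x , ¬Bx)

module Ordinal (em : ExcludedMiddle 0ℓ) (A : Set) where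
  open Classical em

  -- The Boolean distinguishes the empty supremum from one indexed by A.
  data Ord : Set where
    sup : (b : Bool) → (T b × A → Ord) → Ord

  -- `sup b f` stands for the least ordinal strictly above all `f i`; both orders are read off from
  -- this.
  data _≤ₒ_ : Ord → Ord → Set
  data _<ₒ_ : Ord → Ord → Set

  data _≤ₒ_ where
    sup≤ : ∀ {b f β} → (∀ i → f i <ₒ β) → sup b f ≤ₒ β

  data _<ₒ_ where
    <sup : ∀ {α b g} j → α ≤ₒ g j → α <ₒ sup b g

  ≤ₒ-refl : ∀ {α} → α ≤ₒ α
  ≤ₒ-refl {sup b f} = sup≤ λ i → <sup i ≤ₒ-refl

  ≤ₒ-trans : ∀ {α β γ} → α ≤ₒ β → β ≤ₒ γ → α ≤ₒ γ
  <ₒ-≤ₒ-trans : ∀ {α β γ} → α <ₒ β → β ≤ₒ γ → α <ₒ γ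
  ≤ₒ-<ₒ-trans : ∀ {α β γ} → α ≤ₒ β → β <ₒ γ → α <ₒ γ
  ≤ₒ-trans (sup≤ h) q = sup≤ λ i → <ₒ-≤ₒ-trans (h i) q
  <ₒ-≤ₒ-trans (<sup j p) (sup≤ h) = ≤ₒ-<ₒ-trans p (h j)
  ≤ₒ-<ₒ-trans p (<sup j q) = <sup j (≤ₒ-trans p q)

  -- Stated for all `β` up to `α`, so that structural recursion on `α` applies: whatever is below
  -- `β` is at most some branch `f j`.
  ≤ₒ⇒Acc : ∀ α {β} → β ≤ₒ α → Acc _<ₒ_ β
  ≤ₒ⇒Acc (sup b f) β≤α = acc λ γ<β → case <ₒ-≤ₒ-trans γ<β β≤α of λ where
    (<sup j γ≤fj) → ≤ₒ⇒Acc (f j) γ≤fj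

  <ₒ-wellFounded : WellFounded _<ₒ_
  <ₒ-wellFounded α = ≤ₒ⇒Acc α ≤ₒ-refl

  -- If `α ≤ₒ β` fails, some branch `f i` of `α` is not below `β`. Every branch `g j` of `β` is then
  -- below `f i`, as `f i ≤ₒ g j` would put `f i` below `β`. Hence `β ≤ₒ f i`, which is below `α`.
  ≤ₒ-<ₒ-connex : ∀ α β → α ≤ₒ β ⊎ β <ₒ α
  ≤ₒ-<ₒ-connex (sup b f) (sup c g) with em {P = ∀ i → f i <ₒ sup c g}
  ... | yes h = inj₁ (sup≤ h)
  ... | no ¬h = inj₂ (<sup i (sup≤ λ j → case ≤ₒ-<ₒ-connex (f i) (g j) of λ where
      (inj₁ p) → contradiction (<sup j p) ¬fi<
      (inj₂ q) → q))
    where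
    i = proj₁ (¬∀⇒∃¬ ¬h)
    ¬fi< = proj₂ (¬∀⇒∃¬ ¬h)

  ≮ₒ⇒≥ₒ : ∀ {α β} → ¬ α <ₒ β → β ≤ₒ α
  ≮ₒ⇒≥ₒ {α} {β} α≮β with ≤ₒ-<ₒ-connex β α
  ... | inj₁ p = p
  ... | inj₂ q = contradiction q α≮β

  Least : (Ord → Set) → Ord → Set
  Least Q α = Q α × (∀ β → β <ₒ α → ¬ Q β)

  least : ∀ {Q : Ord → Set} → ∃ Q → ∃ (Least Q)
  least {Q} (α , q) = go (<ₒ-wellFounded α) q
    where
    go : ∀ {α} → Acc _<ₒ_ α → Q α → ∃ (Least Q)
    go {α} (acc rs) q with em {P = ∃ λ β → β <ₒ α × Q β}
    ... | yes (β , β<α , qβ) = go (rs β<α) qβ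
    ... | no none = α , q , λ β β<α qβ → none (β , β<α , qβ)

-- Approximants of least and greatest fixed points

dualFP : FP → FP
dualFP μ = ν
dualFP ν = μ

module Fixpoint (em : ExcludedMiddle 0ℓ) (P : Set) where
  open Classical em
  open Ordinal em P public

  Op : Set₁
  Op = Pred P 0ℓ → Pred P 0ℓ

  -- Ψ ⊑ Ψ expresses monotonicity.
  _⊑_ : Op → Op → Set₁
  Ψ ⊑ Ψ′ = ∀ {Y Y′} → Y ⊆ Y′ → Ψ Y ⊆ Ψ′ Y′

  -- The union (for ν, the intersection) of the stages strictly before α; the
  -- stage α itself is Ψ (approx η Ψ α).
  approx : FP → Op → Ord → Pred P 0ℓ
  approx μ Ψ (sup b f) p = ∃ λ i → Ψ (approx μ Ψ (f i)) p
  approx ν Ψ (sup b f) p = ∀ i → Ψ (approx ν Ψ (f i)) p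

  fixpt : FP → Op → Pred P 0ℓ
  fixpt μ Ψ p = ∃ λ α → Ψ (approx μ Ψ α) p
  fixpt ν Ψ p = ∀ α → Ψ (approx ν Ψ α) p

  approx-mono : ∀ η {Ψ Ψ′} → Ψ ⊑ Ψ′ → ∀ α → approx η Ψ α ⊆ approx η Ψ′ α
  approx-mono μ Ψ⊑ (sup b f) (i , x) = i , Ψ⊑ (approx-mono μ Ψ⊑ (f i)) x
  approx-mono ν Ψ⊑ (sup b f) x i = Ψ⊑ (approx-mono ν Ψ⊑ (f i)) (x i)

  fixpt-mono : ∀ η {Ψ Ψ′} → Ψ ⊑ Ψ′ → fixpt η Ψ ⊆ fixpt η Ψ′
  fixpt-mono μ Ψ⊑ (α , x) = α , Ψ⊑ (approx-mono μ Ψ⊑ α) x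
  fixpt-mono ν Ψ⊑ x α = Ψ⊑ (approx-mono ν Ψ⊑ α) (x α)

  approx-μ-≤ : ∀ {Ψ} → Ψ ⊑ Ψ → ∀ {α β} → α ≤ₒ β → approx μ Ψ α ⊆ approx μ Ψ β
  approx-μ-≤ mono (sup≤ h) (i , x) with h i
  ... | <sup j p = j , mono (approx-μ-≤ mono p) x

  approx-μ-< : ∀ {Ψ} α {p} → approx μ Ψ α p → ∃ λ β → β <ₒ α × Ψ (approx μ Ψ β) p
  approx-μ-< (sup b f) (i , x) = f i , <sup i ≤ₒ-refl , x

  -- Each point outside the fixed point leaves at some stage, and the supremum of these stages over
  -- all points is again an ordinal; the approximant there is already contained in the fixed point.
  -- Points that never leave contribute the empty supremum as a default.
  fixpt-ν-unfold : ∀ {Ψ} → Ψ ⊑ Ψ → fixpt ν Ψ ⊆ Ψ (fixpt ν Ψ)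
  fixpt-ν-unfold {Ψ} mono x = mono (λ y → closed y) (x (sup true (λ i → exit (proj₂ i))))
    where
    Exit : P → Set
    Exit q = ∃ λ α → ¬ Ψ (approx ν Ψ α) q

    -- Excluded middle for Σ-types yields witnesses, hence a choice function.
    exit : P → Ord
    exit q with em {P = Exit q}
    ... | yes (α , _) = α
    ... | no _ = sup false λ { (() , _) }

    exit-exits : ∀ q → Exit q → ¬ Ψ (approx ν Ψ (exit q)) q
    exit-exits q e with em {P = Exit q}
    ... | yes (_ , ¬x) = ¬x
    ... | no ¬e = contradiction e ¬e

    closed : approx ν Ψ (sup true (λ i → exit (proj₂ i))) ⊆ fixpt ν Ψ
    closed {q} y α = decidable-stable em λ ¬x → exit-exits q (α , ¬x) (y (tt , q))

  -- De Morgan duality as an inclusion. It carries over from stage to stage and so exchanges least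
  -- and greatest fixed points.
  Dual : Op → Op → Set₁
  Dual Ψ Ψ′ = ∀ {Y Y′} → ∁ Y ⊆ Y′ → ∁ (Ψ Y) ⊆ Ψ′ Y′

  approx-dual : ∀ η {Ψ Ψ′} → Dual Ψ Ψ′ → ∀ α → ∁ (approx η Ψ α) ⊆ approx (dualFP η) Ψ′ α
  approx-dual μ d (sup b f) ¬x i = d (approx-dual μ d (f i)) λ x → ¬x (i , x)
  approx-dual ν d (sup b f) ¬x with ¬∀⇒∃¬ ¬x
  ... | i , ¬xi = i , d (approx-dual ν d (f i)) ¬xi

  fixpt-dual : ∀ η {Ψ Ψ′} → Dual Ψ Ψ′ → ∁ (fixpt η Ψ) ⊆ fixpt (dualFP η) Ψ′
  fixpt-dual μ d ¬x α = d (approx-dual μ d α) λ x → ¬x (α , x)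
  fixpt-dual ν d ¬x with ¬∀⇒∃¬ ¬x
  ... | α , ¬xα = α , d (approx-dual ν d α) ¬xα

  -- A relation and not a function: ordinals that are `≤ₒ` in both directions may differ, and a
  -- point determines its rank only up to this equivalence (`rank-≤`).
  Rank : Op → Ord → P → Set
  Rank Ψ α p = Least (λ β → Ψ (approx μ Ψ β) p) α

  rank : ∀ Ψ {p} → fixpt μ Ψ p → ∃ λ α → Rank Ψ α p
  rank _ = least

  rank-≤ : ∀ Ψ {α β p} → Rank Ψ α p → Rank Ψ β p → α ≤ₒ β
  rank-≤ _ (_ , low) (x , _) = ≮ₒ⇒≥ₒ λ β<α → low _ β<α x

  rank-mono : ∀ {Ψ Ψ′ α p} → Ψ ⊑ Ψ′ → Ψ′ ⊑ Ψ → Rank Ψ α p → Rank Ψ′ α p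
  rank-mono {α = α} Ψ⊑ ⊒Ψ (x , low) =
    Ψ⊑ (approx-mono μ Ψ⊑ α) x ,
    λ β β<α y → low β β<α (⊒Ψ (approx-mono μ ⊒Ψ β) y)

-- Positional determinacy of parity games

polarity : Player → Player → FP
polarity I  I  = ν
polarity I  II = μ
polarity II I  = μ
polarity II II = ν

-- Priorities won by `pl` may recur forever, so their levels are greatest fixed points; those of the
-- opponent must die out, so their levels are least ones.
polarity-ν : ∀ pl q → polarity pl q ≡ ν → q ≡ pl
polarity-ν I  I  _ = refl
polarity-ν II II _ = refl

polarity-dual : ∀ q → dualFP (polarity I q) ≡ polarity II q
polarity-dual I  = refl
polarity-dual II = refl

module ParityGame (em : ExcludedMiddle 0ℓ) {P : Set} (Move : P → P → Set)
  (owner : P → Player) (prio : P → ℕ) (winner : ℕ → Player) where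
  open Classical em
  open Fixpoint em P

  -- At a dead end the second case holds vacuously, so being stuck is a loss for the owner.
  Forces : Player → Pred P 0ℓ → Pred P 0ℓ
  Forces pl Y p =
    (owner p ≡ pl × ∃ λ p′ → Move p p′ × Y p′) ⊎
    (owner p ≡ opponent pl × (∀ p′ → Move p p′ → Y p′))

  Forces-mono : ∀ {pl Y Y′} → Y ⊆ Y′ → Forces pl Y ⊆ Forces pl Y′
  Forces-mono Y⊆ (inj₁ (o , p′ , m , y)) = inj₁ (o , p′ , m , Y⊆ y)
  Forces-mono Y⊆ (inj₂ (o , h)) = inj₂ (o , λ p′ m → Y⊆ (h p′ m))

  Forces-dual : ∀ {Y Y′} → ∁ Y ⊆ Y′ → ∁ (Forces I Y) ⊆ Forces II Y′
  Forces-dual ∁Y⊆ {p} ¬f with owner p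
  ... | I  = inj₂ (refl , λ p′ m → ∁Y⊆ λ y → ¬f (inj₁ (refl , p′ , m , y)))
  ... | II with ¬∀⇒∃¬ (λ h → ¬f (inj₂ (refl , h)))
  ...   | p′ , ¬h with ¬∀⇒∃¬ ¬h
  ...     | m , ¬y = inj₁ (refl , p′ , m , ∁Y⊆ ¬y)

  Targets : Set₁
  Targets = ℕ → Pred P 0ℓ

  -- Targets are numbered from the current level upwards. One level further down, priority `n` joins
  -- the list with target `Y` and the others shift by one.
  _◂_ : Pred P 0ℓ → Targets → Targets
  (Y ◂ X) zero    = Y
  (Y ◂ X) (suc j) = X j

  ◂-mono : ∀ {Y Y′ X X′} → Y ⊆ Y′ → (∀ j → X j ⊆ X′ j) → ∀ j → (Y ◂ X) j ⊆ (Y′ ◂ X′) j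
  ◂-mono Y⊆ X⊆ zero    = Y⊆
  ◂-mono Y⊆ X⊆ (suc j) = X⊆ j

  -- From Region pl n X the player pl can force that the play is either won
  -- with priorities below n only, or that the first position of priority
  -- n + j ≥ n is left towards X j.
  Region : Player → ℕ → Targets → Pred P 0ℓ
  Region pl zero    X p = Forces pl (X (prio p)) p
  Region pl (suc n) X = fixpt (polarity pl (winner n)) (λ Y → Region pl n (Y ◂ X))

  Region-mono : ∀ pl n {X X′} → (∀ j → X j ⊆ X′ j) → Region pl n X ⊆ Region pl n X′
  Region-mono pl zero X⊆ {p} = Forces-mono (X⊆ (prio p))
  Region-mono pl (suc n) X⊆ =
    fixpt-mono (polarity pl (winner n)) (λ Y⊆ → Region-mono pl n (◂-mono Y⊆ X⊆))

  -- Exchanging the players flips the polarity of every level and, at the bottom, swaps the two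
  -- cases of `Forces`.
  Region-dual : ∀ n {X X′} → (∀ j → ∁ (X j) ⊆ X′ j) → ∁ (Region I n X) ⊆ Region II n X′
  Region-dual zero ∁X⊆ {p} = Forces-dual (∁X⊆ (prio p))
  Region-dual (suc n) {X} {X′} ∁X⊆ {p} ¬r =
    subst (λ η → fixpt η (λ Y → Region II n (Y ◂ X′)) p) (polarity-dual (winner n))
      (fixpt-dual (polarity I (winner n))
        (λ ∁Y⊆ → Region-dual n λ where
          zero    → ∁Y⊆
          (suc j) → ∁X⊆ j)
        ¬r)

  -- Good moves and the regions they preserve

  module _ (pl : Player) where

    Step : ℕ → Targets → Op
    Step n X Y = Region pl n (Y ◂ X)

    Step-mono : ∀ n {X X′} → (∀ j → X j ⊆ X′ j) → Step n X ⊑ Step n X′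
    Step-mono n X⊆ Y⊆ = Region-mono pl n (◂-mono Y⊆ X⊆)

    -- A nondeterministic positional strategy.  It depends on a rank only
    -- through the approximant of that rank (Good-ext), so that equivalent
    -- but distinct ordinals give the same moves.
    Good : ℕ → Targets → P → P → Set
    GoodStep : FP → ℕ → Targets → P → P → Set
    Good zero    X p p′ = X (prio p) p′
    Good (suc n) X = GoodStep (polarity pl (winner n)) n X
    GoodStep ν n X = Good n (fixpt ν (Step n X) ◂ X)
    GoodStep μ n X p p′ =
      ∃ λ α → Rank (Step n X) α p × Good n (approx μ (Step n X) α ◂ X) p p′

    Good-ext : ∀ n {X X′ p p′} → (∀ j → X j ⊆ X′ j) → (∀ j → X′ j ⊆ X j) →
      Good n X p p′ → Good n X′ p p′
    Good-ext zero {p = p} X⊆ ⊇X g = X⊆ (prio p) g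
    Good-ext (suc n) X⊆ ⊇X g with polarity pl (winner n)
    ... | ν = Good-ext n
          (◂-mono (fixpt-mono ν (Step-mono n X⊆)) X⊆)
          (◂-mono (fixpt-mono ν (Step-mono n ⊇X)) ⊇X) g
    Good-ext (suc n) X⊆ ⊇X (α , r , g) | μ =
      α , rank-mono (Step-mono n X⊆) (Step-mono n ⊇X) r ,
      Good-ext n
        (◂-mono (approx-mono μ (Step-mono n X⊆) α) X⊆)
        (◂-mono (approx-mono μ (Step-mono n ⊇X) α) ⊇X) g

    unfold : ∀ n {X} → fixpt ν (Step n X) ⊆ Region pl n (fixpt ν (Step n X) ◂ X)
    unfold n {X} = fixpt-ν-unfold {Step n X} (Step-mono n (λ _ x → x))

    -- Opening the levels one by one, a ν-level at the fixed point itself and a μ-level at the stage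
    -- given by the rank, ends in `Forces` at level zero.
    Good-enabled : ∀ n {X p} → Region pl n X p → Forces pl (Good n X p) p
    Good-enabled zero r = r
    Good-enabled (suc n) {X} r with polarity pl (winner n)
    ... | ν = Good-enabled n (unfold n r)
    ... | μ with rank (Step n X) r
    ...   | α , rk = Forces-mono (λ g → α , rk , g) (Good-enabled n (proj₁ rk))

    Good-exit : ∀ n {X p p′} j → Region pl n X p → Good n X p p′ → prio p ≡ n + j → X j p′
    Good-exit zero j r g refl = g
    Good-exit (suc n) {p = p} j r g e with polarity pl (winner n)
    ... | ν = Good-exit n (suc j) (unfold n r) g (trans e (sym (+-suc n j)))
    Good-exit (suc n) j r (α , rk , g) e | μ =
      Good-exit n (suc j) (proj₁ rk) g (trans e (sym (+-suc n j)))

    -- Below priority `n` the play remains inside level `n`: at a ν-level the target is the fixed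
    -- point, which lies in every approximant, and at a μ-level the stage is kept. At priority `n`
    -- the move goes to the target of that level: the fixed point for ν, an earlier stage for μ.
    Good-stay : ∀ n {X p p′} → Region pl n X p → Good n X p p′ → prio p < n → Region pl n X p′
    Good-stay (suc n) {p = p} r g p< with polarity pl (winner n) | m<1+n⇒m<n∨m≡n p<
    ... | ν | inj₁ p<n = λ α →
          Region-mono pl n (◂-mono (λ y → below α y) (λ _ x → x)) (Good-stay n (unfold n r) g p<n)
      where
      below : ∀ α → fixpt ν (Step n _) ⊆ approx ν (Step n _) α
      below (sup b f) y i = y (f i)
    ... | ν | inj₂ p≡n = Good-exit n 0 (unfold n r) g (trans p≡n (sym (+-identityʳ n)))
    Good-stay (suc n) r (α , rk , g) _ | μ | inj₁ p<n = α , Good-stay n (proj₁ rk) g p<n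
    Good-stay (suc n) r (α , rk , g) _ | μ | inj₂ p≡n
      with approx-μ-< α (Good-exit n 0 (proj₁ rk) g (trans p≡n (sym (+-identityʳ n))))
    ... | β , _ , x = β , x

    -- Plays along good moves

    Wins : (ℕ → P) → Set
    Wins f = ∃ λ k → winner k ≡ pl ×
      (∀ m → ∃ λ i → prio (f (i + m)) ≡ k) × (∃ λ N → ∀ i → prio (f (i + N)) ≤ k)

    Wins-drop : ∀ d f → Wins (λ i → f (i + d)) → Wins f
    Wins-drop d f (k , w , inf , N , ev) = k , w , inf′ , N + d , ev′
      where
      inf′ : ∀ m → ∃ λ i → prio (f (i + m)) ≡ k
      inf′ m with inf m
      ... | i , e = i + d , trans (cong (prio ∘ f) lemma) e
        where
        lemma : i + d + m ≡ i + m + d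
        lemma = trans (+-assoc i d m) (trans (cong (i +_) (+-comm d m)) (sym (+-assoc i m d)))
      ev′ : ∀ i → prio (f (i + (N + d))) ≤ k
      ev′ i = subst (λ j → prio (f j) ≤ k) (+-assoc i N d) (ev i)

    Good-Region : ∀ n {X} {f : ℕ → P} → Region pl n X (f 0) → (∀ i → Good n X (f i) (f (suc i))) →
      (∀ i → prio (f i) < n) → ∀ i → Region pl n X (f i)
    Good-Region n r g p< zero    = r
    Good-Region n r g p< (suc i) = Good-stay n (Good-Region n r g p< i) (g i) (p< i)

    WinsBelow : ℕ → Set₁
    WinsBelow n = ∀ {X} {f : ℕ → P} → Region pl n X (f 0) → (∀ i → Good n X (f i) (f (suc i))) →
      (∀ i → prio (f i) < n) → Wins f

    -- Either some tail avoids priority `n` and is won at the lower levels, or `n` recurs; it is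
    -- then the greatest recurring priority, and `pl` wins it.
    ν-wins : ∀ {n} → WinsBelow n → winner n ≡ pl → ∀ {X} {f : ℕ → P} →
      (∀ i → fixpt ν (Step n X) (f i)) → (∀ i → GoodStep ν n X (f i) (f (suc i))) →
      (∀ i → prio (f i) < suc n) → Wins f
    ν-wins {n} below w {X} {f} rs g p< with em {P = ∃ λ m → ∀ i → ¬ prio (f (i + m)) ≡ n}
    ... | yes (m , never) = Wins-drop m f (below (unfold n (rs m)) (λ i → g (i + m))
            λ i → ≤∧≢⇒< (s≤s⁻¹ (p< (i + m))) (never i))
    ... | no recur = n , w ,
            (λ m → case ¬∀⇒∃¬ (λ h → recur (m , h)) of λ where
              (i , ¬¬e) → i , decidable-stable em ¬¬e) ,
            0 , λ i → s≤s⁻¹ (p< (i + 0))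

    μ-wins : ∀ {n} → WinsBelow n → ∀ {X} {f : ℕ → P} →
      fixpt μ (Step n X) (f 0) → (∀ i → GoodStep μ n X (f i) (f (suc i))) →
      (∀ i → prio (f i) < suc n) → Wins f
    μ-wins {n} below {X} {f} r g p< with rank (Step n X) r
    ... | α₀ , rk₀ = go 0 (<ₒ-wellFounded α₀) rk₀
      where
      Ψ = Step n X

      -- Once the rank has stopped decreasing, priority n is not met any more.
      go : ∀ m {α} → Acc _<ₒ_ α → Rank Ψ α (f m) → Wins f
      go m {α} (acc rs) rk
        with em {P = ∃ λ i → ∃ λ β → β <ₒ α × Rank Ψ β (f (i + m))}
      ... | yes (i , β , β<α , rkβ) = go (i + m) (rs β<α) rkβ
      ... | no stable = Wins-drop m f (below (proj₁ rk) good prio<n)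
        where
        -- Entering a stage below `α` would yield a rank below `α`, against `stable`.
        no-drop : ∀ i {β} → β <ₒ α → ¬ Ψ (approx μ Ψ β) (f (i + m))
        no-drop i {β} β<α x with rank Ψ (β , x)
        ... | γ , rkγ with ≤ₒ-<ₒ-connex γ β
        ...   | inj₁ γ≤β = stable (i , γ , ≤ₒ-<ₒ-trans γ≤β β<α , rkγ)
        ...   | inj₂ β<γ = proj₂ rkγ β β<γ x

        -- The move is good for some rank `β`, equivalent to `α` but perhaps distinct; `Good-ext`
        -- passes from one approximant to the other.
        good-at : ∀ i → Rank Ψ α (f (i + m)) → Good n (approx μ Ψ α ◂ X) (f (i + m)) (f (suc i + m))
        good-at i rkᵢ with g (i + m)
        ... | β , rkβ , gβ = Good-ext n
          (◂-mono (approx-μ-≤ (Step-mono n (λ _ x → x)) (rank-≤ Ψ rkβ rkᵢ)) (λ _ x → x))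
          (◂-mono (approx-μ-≤ (Step-mono n (λ _ x → x)) (rank-≤ Ψ rkᵢ rkβ)) (λ _ x → x)) gβ

        -- At priority `n` the move would lead into a stage before `α`.
        prio-at : ∀ i → Rank Ψ α (f (i + m)) → prio (f (i + m)) < n
        prio-at i rkᵢ = ≤∧≢⇒< (s≤s⁻¹ (p< (i + m))) λ e →
          case approx-μ-< α (Good-exit n 0 (proj₁ rkᵢ) (good-at i rkᵢ)
                 (trans e (sym (+-identityʳ n)))) of λ where
            (β , β<α , x) → no-drop (suc i) β<α x

        rk-at : ∀ i → Rank Ψ α (f (i + m))
        rk-at zero = rk
        rk-at (suc i) = Good-stay n (proj₁ (rk-at i)) (good-at i (rk-at i)) (prio-at i (rk-at i)) ,
          λ β β<α → no-drop (suc i) β<α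

        good : ∀ i → Good n (approx μ Ψ α ◂ X) (f (i + m)) (f (suc i + m))
        good i = good-at i (rk-at i)

        prio<n : ∀ i → prio (f (i + m)) < n
        prio<n i = prio-at i (rk-at i)

    Good-wins : ∀ n → WinsBelow n
    Good-wins zero r g p< = case p< 0 of λ ()
    Good-wins (suc n) {X} {f} r g p< =
      -- With the polarity as a variable, one match refines the region, the moves and the claim
      -- about `winner n` together.
      by-polarity (polarity pl (winner n)) (polarity-ν pl (winner n))
        (Good-Region (suc n) r g p<) g
      where
      by-polarity : ∀ η → (η ≡ ν → winner n ≡ pl) → (∀ i → fixpt η (Step n X) (f i)) →
        (∀ i → GoodStep η n X (f i) (f (suc i))) → Wins f
      by-polarity ν w rs g = ν-wins (Good-wins n) (w refl) rs g p<
      by-polarity μ _ rs g = μ-wins (Good-wins n) (rs 0) g p<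

  -- Determinacy for bounded priorities

  module _ (N : ℕ) (prio<N : ∀ p → prio p < N) where

    -- No position has priority ≥ N, so the targets are irrelevant.
    targets : Targets
    targets _ _ = ⊤

    WinRegion : Player → Pred P 0ℓ
    WinRegion pl = Region pl N targets

    determined : ∀ p → WinRegion I p ⊎ WinRegion II p
    determined p with em {P = WinRegion I p}
    ... | yes r = inj₁ r
    ... | no ¬r = inj₂ (Region-dual N (λ _ _ → tt) ¬r)

    module _ (pl : Player) where

      GoodMove : P → P → Set
      GoodMove p p′ = Move p p′ × Good pl N targets p p′

      -- Where no good move exists any move is taken, so that the strategy is legal everywhere; a
      -- dead end is sent to itself as a default.
      strategy : P → P
      strategy p with em {P = ∃ (GoodMove p)} | em {P = ∃ (Move p)}
      ... | yes (p′ , _) | _            = p′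
      ... | no _         | yes (p′ , _) = p′
      ... | no _         | no _         = p

      strategy-move : ∀ p → ∃ (Move p) → Move p (strategy p)
      strategy-move p m with em {P = ∃ (GoodMove p)} | em {P = ∃ (Move p)}
      ... | yes (_ , m′ , _) | _            = m′
      ... | no _             | yes (_ , m′) = m′
      ... | no _             | no ¬m        = contradiction m ¬m

      strategy-good : ∀ p → ∃ (GoodMove p) → Good pl N targets p (strategy p)
      strategy-good p g with em {P = ∃ (GoodMove p)} | em {P = ∃ (Move p)}
      ... | yes (_ , _ , g′) | _ = g′
      ... | no ¬g            | _ = contradiction g ¬g

      follow-good : ∀ {p p′} → WinRegion pl p → Move p p′ →
        (owner p ≡ pl → p′ ≡ strategy p) → Good pl N targets p p′
      follow-good {p} r m follows with Good-enabled pl N r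
      ... | inj₁ (o , g) = subst (Good pl N targets p) (sym (follows o)) (strategy-good p g)
      ... | inj₂ (o , g) = g _ m

      follow-stay : ∀ {p p′} → WinRegion pl p → Move p p′ →
        (owner p ≡ pl → p′ ≡ strategy p) → WinRegion pl p′
      follow-stay {p} r m follows = Good-stay pl N r (follow-good r m follows) (prio<N p)

      stuck-owner : ∀ {p} → WinRegion pl p → ¬ ∃ (Move p) → owner p ≡ opponent pl
      stuck-owner r stuck with Good-enabled pl N r
      ... | inj₁ (_ , p′ , m , _) = contradiction (p′ , m) stuck
      ... | inj₂ (o , _) = o

      follow-wins : ∀ {f : ℕ → P} → WinRegion pl (f 0) → (∀ i → Move (f i) (f (suc i))) →
        (∀ i → owner (f i) ≡ pl → f (suc i) ≡ strategy (f i)) → Wins pl f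
      follow-wins {f} r moves follows =
        Good-wins pl N r (λ i → follow-good (stay i) (moves i) (follows i)) (λ i → prio<N (f i))
        where
        stay : ∀ i → WinRegion pl (f i)
        stay zero    = r
        stay (suc i) = follow-stay (stay i) (moves i) (follows i)

-- Subformulas, binders and free variables

module Syntax (em : ExcludedMiddle 0ℓ) {Prop Var : Set} where

  Formula : Set
  Formula = Fm Prop Var

  -- The constructors ⇒f and ◇f count twice, to leave room for the auxiliary
  -- positions between them and their arguments.
  size : Formula → ℕ
  size (prop _)    = 0
  size (var _)     = 0
  size ⊥f          = 0
  size (a ∧f b)    = suc (size a + size b)
  size (a ∨f b)    = suc (size a + size b)
  size (a ⇒f b)    = suc (suc (size a + size b))
  size (□f a)      = suc (size a)
  size (◇f a)      = suc (suc (size a))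
  size (fix _ _ a) = suc (size a)

  Sub-trans : ∀ {a b c : Formula} → Sub a b → Sub b c → Sub a c
  Sub-trans s here     = s
  Sub-trans s (∧l t)   = ∧l (Sub-trans s t)
  Sub-trans s (∧r t)   = ∧r (Sub-trans s t)
  Sub-trans s (∨l t)   = ∨l (Sub-trans s t)
  Sub-trans s (∨r t)   = ∨r (Sub-trans s t)
  Sub-trans s (⇒l t)   = ⇒l (Sub-trans s t)
  Sub-trans s (⇒r t)   = ⇒r (Sub-trans s t)
  Sub-trans s (□s t)   = □s (Sub-trans s t)
  Sub-trans s (◇s t)   = ◇s (Sub-trans s t)
  Sub-trans s (fixs t) = fixs (Sub-trans s t)

  Sub-size-≤ : ∀ {a b : Formula} → Sub a b → size a ≤ size b
  Sub-size-< : ∀ {a b : Formula} → Sub a b → a ≡ b ⊎ size a < size b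
  Sub-size-≤ s with Sub-size-< s
  ... | inj₁ refl = ≤-refl
  ... | inj₂ lt   = <⇒≤ lt
  Sub-size-< here     = inj₁ refl
  Sub-size-< (∧l s)   = inj₂ (s≤s (m≤n⇒m≤n+o _ (Sub-size-≤ s)))
  Sub-size-< (∧r s)   = inj₂ (s≤s (m≤n⇒m≤o+n _ (Sub-size-≤ s)))
  Sub-size-< (∨l s)   = inj₂ (s≤s (m≤n⇒m≤n+o _ (Sub-size-≤ s)))
  Sub-size-< (∨r s)   = inj₂ (s≤s (m≤n⇒m≤o+n _ (Sub-size-≤ s)))
  Sub-size-< (⇒l s)   = inj₂ (m<n⇒m<1+n (s≤s (m≤n⇒m≤n+o _ (Sub-size-≤ s))))
  Sub-size-< (⇒r s)   = inj₂ (m<n⇒m<1+n (s≤s (m≤n⇒m≤o+n _ (Sub-size-≤ s))))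
  Sub-size-< (□s s)   = inj₂ (s≤s (Sub-size-≤ s))
  Sub-size-< (◇s s)   = inj₂ (m<n⇒m<1+n (s≤s (Sub-size-≤ s)))
  Sub-size-< (fixs s) = inj₂ (s≤s (Sub-size-≤ s))

  Sub-size-≡ : ∀ {a b : Formula} → Sub a b → size b ≤ size a → a ≡ b
  Sub-size-≡ s le with Sub-size-< s
  ... | inj₁ e  = e
  ... | inj₂ lt = contradiction le (<⇒≱ lt)

  Sub-antisym : ∀ {a b : Formula} → Sub a b → Sub b a → a ≡ b
  Sub-antisym s t = Sub-size-≡ s (Sub-size-≤ t)

  binder∈ : ∀ {η X a} {φ : Formula} → Sub (fix η X a) φ → X ∈ binders φ
  binder∈ here = here refl
  binder∈ (∧l s) = ∈-++⁺ˡ (binder∈ s)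
  binder∈ {φ = a ∧f _} (∧r s) = ∈-++⁺ʳ (binders a) (binder∈ s)
  binder∈ (∨l s) = ∈-++⁺ˡ (binder∈ s)
  binder∈ {φ = a ∨f _} (∨r s) = ∈-++⁺ʳ (binders a) (binder∈ s)
  binder∈ (⇒l s) = ∈-++⁺ˡ (binder∈ s)
  binder∈ {φ = a ⇒f _} (⇒r s) = ∈-++⁺ʳ (binders a) (binder∈ s)
  binder∈ (□s s) = binder∈ s
  binder∈ (◇s s) = binder∈ s
  binder∈ (fixs s) = there (binder∈ s)

  Unique-++⁻ˡ : ∀ (xs : List Var) {ys} → Unique (xs ++ ys) → Unique xs
  Unique-++⁻ˡ []       u        = []
  Unique-++⁻ˡ (x ∷ xs) (px ∷ u) = All.++⁻ˡ xs px ∷ Unique-++⁻ˡ xs u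

  Unique-++⁻ʳ : ∀ (xs : List Var) {ys} → Unique (xs ++ ys) → Unique ys
  Unique-++⁻ʳ []       u       = u
  Unique-++⁻ʳ (x ∷ xs) (_ ∷ u) = Unique-++⁻ʳ xs u

  Unique-++-disjoint : ∀ (xs : List Var) {ys x} → Unique (xs ++ ys) → x ∈ xs → ¬ x ∈ ys
  Unique-++-disjoint (x ∷ xs) (px ∷ _) (here refl) x∈ys = All.lookup (All.++⁻ʳ xs px) x∈ys refl
  Unique-++-disjoint (x ∷ xs) (_ ∷ u) (there x∈xs) x∈ys = Unique-++-disjoint xs u x∈xs x∈ys

  -- Two different places binding `X` would make `X` occur twice in the list of binders, either in
  -- both halves of a concatenation or as head and again in the tail.
  binder-unique : ∀ {η X a η′ a′} (φ : Formula) → Unique (binders φ) →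
    Sub (fix η X a) φ → Sub (fix η′ X a′) φ → fix η X a ≡ fix η′ X a′
  binder-unique-++ : ∀ {η X a η′ a′} (b c : Formula) → Unique (binders b ++ binders c) →
    Sub (fix η X a) b ⊎ Sub (fix η X a) c → Sub (fix η′ X a′) b ⊎ Sub (fix η′ X a′) c →
    fix η X a ≡ fix η′ X a′
  binder-unique φ u here here = refl
  binder-unique (fix _ _ _) (px ∷ _) here (fixs t) = contradiction refl (All.lookup px (binder∈ t))
  binder-unique (fix _ _ _) (px ∷ _) (fixs s) here = contradiction refl (All.lookup px (binder∈ s))
  binder-unique (fix _ _ b) (_ ∷ u) (fixs s) (fixs t) = binder-unique b u s t
  binder-unique (□f b) u (□s s) (□s t) = binder-unique b u s t
  binder-unique (◇f b) u (◇s s) (◇s t) = binder-unique b u s t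
  binder-unique (b ∧f c) u (∧l s) (∧l t) = binder-unique-++ b c u (inj₁ s) (inj₁ t)
  binder-unique (b ∧f c) u (∧l s) (∧r t) = binder-unique-++ b c u (inj₁ s) (inj₂ t)
  binder-unique (b ∧f c) u (∧r s) (∧l t) = binder-unique-++ b c u (inj₂ s) (inj₁ t)
  binder-unique (b ∧f c) u (∧r s) (∧r t) = binder-unique-++ b c u (inj₂ s) (inj₂ t)
  binder-unique (b ∨f c) u (∨l s) (∨l t) = binder-unique-++ b c u (inj₁ s) (inj₁ t)
  binder-unique (b ∨f c) u (∨l s) (∨r t) = binder-unique-++ b c u (inj₁ s) (inj₂ t)
  binder-unique (b ∨f c) u (∨r s) (∨l t) = binder-unique-++ b c u (inj₂ s) (inj₁ t)
  binder-unique (b ∨f c) u (∨r s) (∨r t) = binder-unique-++ b c u (inj₂ s) (inj₂ t)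
  binder-unique (b ⇒f c) u (⇒l s) (⇒l t) = binder-unique-++ b c u (inj₁ s) (inj₁ t)
  binder-unique (b ⇒f c) u (⇒l s) (⇒r t) = binder-unique-++ b c u (inj₁ s) (inj₂ t)
  binder-unique (b ⇒f c) u (⇒r s) (⇒l t) = binder-unique-++ b c u (inj₂ s) (inj₁ t)
  binder-unique (b ⇒f c) u (⇒r s) (⇒r t) = binder-unique-++ b c u (inj₂ s) (inj₂ t)
  binder-unique-++ b c u (inj₁ s) (inj₁ t) = binder-unique b (Unique-++⁻ˡ (binders b) u) s t
  binder-unique-++ b c u (inj₂ s) (inj₂ t) = binder-unique c (Unique-++⁻ʳ (binders b) u) s t
  binder-unique-++ b c u (inj₁ s) (inj₂ t) =
    contradiction (binder∈ t) (Unique-++-disjoint (binders b) u (binder∈ s))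
  binder-unique-++ b c u (inj₂ s) (inj₁ t) =
    contradiction (binder∈ s) (Unique-++-disjoint (binders b) u (binder∈ t))

  BoundAbove : Var → Formula → Formula → Set
  BoundAbove X ψ φ = ∃ λ η → ∃ λ a → Sub (fix η X a) φ × Sub ψ a

  -- On the way up from `ψ` to `φ` the variable stays free until a binder of it is passed.
  free-or-bound : ∀ {X} {ψ φ : Formula} → Free X ψ → Sub ψ φ → Free X φ ⊎ BoundAbove X ψ φ
  free-or-bound {X} {ψ} fr = go
    where
    lift : ∀ {a b} → (Free X a → Free X b) → (∀ {c} → Sub c a → Sub c b) →
      Free X a ⊎ BoundAbove X ψ a → Free X b ⊎ BoundAbove X ψ b
    lift f s (inj₁ x) = inj₁ (f x)
    lift f s (inj₂ (η , a , t , u)) = inj₂ (η , a , s t , u)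

    flip-occ : ∀ {p a} → Occ p X a → Occ (flipP {Prop} {Var} (flipP {Prop} {Var} p)) X a
    flip-occ {even} o = o
    flip-occ {odd} o = o

    go : ∀ {φ} → Sub ψ φ → Free X φ ⊎ BoundAbove X ψ φ
    go here   = inj₁ fr
    go (∧l s) = lift (λ (p , o) → p , occ-∧l o) ∧l (go s)
    go (∧r s) = lift (λ (p , o) → p , occ-∧r o) ∧r (go s)
    go (∨l s) = lift (λ (p , o) → p , occ-∨l o) ∨l (go s)
    go (∨r s) = lift (λ (p , o) → p , occ-∨r o) ∨r (go s)
    -- An antecedent reverses parity, so the occurrence is handed on with the flipped one.
    go (⇒l s) = lift (λ (p , o) → flipP {Prop} {Var} p , occ-⇒l (flip-occ o)) ⇒l (go s)
    go (⇒r s) = lift (λ (p , o) → p , occ-⇒r o) ⇒r (go s)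
    go (□s s) = lift (λ (p , o) → p , occ-□ o) □s (go s)
    go (◇s s) = lift (λ (p , o) → p , occ-◇ o) ◇s (go s)
    go {fix η Y a} (fixs s) with em {P = Y ≡ X}
    ... | yes refl = inj₂ (η , a , here , s)
    ... | no Y≢X   = lift (λ (p , o) → p , occ-fix Y≢X o) fixs (go s)

  module _ {φ : Formula} (sentence : Sentence φ) (unique : Unique (binders φ)) where

    bound : ∀ {X} {ψ : Formula} → Free X ψ → Sub ψ φ → BoundAbove X ψ φ
    bound {X} fr s with free-or-bound fr s
    ... | inj₁ fr′ = contradiction fr′ (sentence X)
    ... | inj₂ b = b

    -- If `X` is bound inside `F`, its binder there is the given one by uniqueness, which thus lies
    -- in `F`. Otherwise `X` is free in `F`, and its binder, again the given one, lies above `F`.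
    binder-comparable : ∀ {η X a} {F : Formula} → Sub F φ → Sub (var X) F →
      Sub (fix η X a) φ → Sub (fix η X a) F ⊎ Sub F (fix η X a)
    binder-comparable {F = F} sF sX sG with free-or-bound (even , occ-var) sX
    ... | inj₂ (_ , _ , s , _) =
          inj₁ (subst (λ G → Sub G F) (binder-unique φ unique (Sub-trans s sF) sG) s)
    ... | inj₁ fr with bound fr sF
    ...   | _ , _ , s , t = inj₂ (subst (Sub F) (binder-unique φ unique s sG) (fixs t))

-- Priorities: twice a size plus a bit for the owner

code : ℕ → Player → ℕ
code zero    I  = 0
code zero    II = 1
code (suc k) q  = suc (suc (code k q))

codeWinner : ℕ → Player
codeWinner 0             = I
codeWinner 1             = II
codeWinner (suc (suc n)) = codeWinner n

codeWinner-code : ∀ k q → codeWinner (code k q) ≡ q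
codeWinner-code zero    I  = refl
codeWinner-code zero    II = refl
codeWinner-code (suc k) q  = codeWinner-code k q

code-cancel-≤ : ∀ {k j} q r → code k q ≤ code j r → k ≤ j
code-cancel-≤ {zero} q r le = z≤n
code-cancel-≤ {suc k} {zero} q I ()
code-cancel-≤ {suc k} {zero} q II (s≤s ())
code-cancel-≤ {suc k} {suc j} q r (s≤s (s≤s le)) = s≤s (code-cancel-≤ q r le)

code-< : ∀ {k j} q → k ≤ j → code k q < code (suc j) I
code-< I  (z≤n {zero})  = s≤s z≤n
code-< I  (z≤n {suc j}) = s≤s z≤n
code-< II (z≤n {j})     = s≤s (s≤s z≤n)
code-< q  (s≤s le)      = s≤s (s≤s (code-< q le))

-- The evaluation game as a parity game

module PositionFormula {Prop Var : Set} (M : CKModel Prop) (φ : Fm Prop Var) where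
  open Game M φ

  -- Auxiliary positions keep the formula they come from, so that subformulas of `φ` lead only to
  -- subformulas of `φ` (`Sub-move-φ`).
  formula : Position → Fm Prop Var
  formula (pos _ ψ _)    = ψ
  formula (◇pos _ ψ _)   = ◇f ψ
  formula (?pos _ ψ θ _) = ψ ⇒f θ

module Evaluation (em : ExcludedMiddle 0ℓ) {Prop Var : Set} (M : CKModel Prop)
  (w : CKModel.W M) (φ : Fm Prop Var) (sentence : Sentence φ) (unique : Unique (binders φ)) where
  open Game M φ
  open CKModel M using (W⊥; V)
  open PositionFormula M φ
  open Classical em
  open Syntax em {Prop} {Var}

  -- A position outside `φ`, such as an unbound variable, may have no owner; `II` is then the
  -- default. On subformulas of `φ` this agrees with `Owner` (`Owner-owner`).
  owner : Position → Player
  owner p with em {P = Owner p I}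
  ... | yes _ = I
  ... | no _  = II

  formulaOwner : Formula → Player
  formulaOwner F with em {P = OwnedByI w F}
  ... | yes _ = I
  ... | no _  = II

  formulaOwner-I : ∀ {F} → formulaOwner F ≡ I → OwnedByI w F
  formulaOwner-I {F} e with em {P = OwnedByI w F}
  ... | yes o = o
  formulaOwner-I () | no _

  formulaOwner-II : ∀ {F} → formulaOwner F ≡ II → ¬ OwnedByI w F
  formulaOwner-II {F} e with em {P = OwnedByI w F}
  formulaOwner-II () | yes _
  ... | no ¬o = ¬o

  fixPrio : Formula → ℕ
  fixPrio F = code (size F) (formulaOwner F)

  Binder : Var → Set
  Binder X = ∃ λ η → ∃ λ a → Sub (fix η X a) φ

  -- Regeneration happens at variables. The value 0 of the other positions differs from every
  -- priority of a fixed-point formula, whose size is positive.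
  prio : Position → ℕ
  prio (pos _ (var X) _) with em {P = Binder X}
  ... | yes (η , a , _) = fixPrio (fix η X a)
  ... | no _            = 0
  prio _ = 0

  prio-bound : ∀ p → prio p < code (suc (size φ)) I
  prio-bound (pos _ (var X) _) with em {P = Binder X}
  ... | yes (_ , _ , s) = code-< _ (Sub-size-≤ s)
  ... | no _            = s≤s z≤n
  prio-bound (pos _ (prop _) _)    = s≤s z≤n
  prio-bound (pos _ ⊥f _)          = s≤s z≤n
  prio-bound (pos _ (_ ∧f _) _)    = s≤s z≤n
  prio-bound (pos _ (_ ∨f _) _)    = s≤s z≤n
  prio-bound (pos _ (_ ⇒f _) _)    = s≤s z≤n
  prio-bound (pos _ (□f _) _)      = s≤s z≤n
  prio-bound (pos _ (◇f _) _)      = s≤s z≤n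
  prio-bound (pos _ (fix _ _ _) _) = s≤s z≤n
  prio-bound (◇pos _ _ _)          = s≤s z≤n
  prio-bound (?pos _ _ _ _)        = s≤s z≤n

  prio-regen : ∀ {F p p′} → Move p p′ → Regen w F p p′ → Sub F φ × prio p ≡ fixPrio F
  prio-regen (m-X {X = X} s) regen with em {P = Binder X}
  ... | yes (_ , _ , t) = s , cong fixPrio (binder-unique φ unique t s)
  ... | no none = contradiction (_ , _ , s) none

  regen-of : ∀ {p p′} → prio p ≢ 0 → Move p p′ → ∃ λ F → Regen w F p p′
  regen-of _  (m-X _)   = _ , regen
  regen-of ≢0 m-∨l      = contradiction refl ≢0
  regen-of ≢0 m-∨r      = contradiction refl ≢0
  regen-of ≢0 m-?l      = contradiction refl ≢0
  regen-of ≢0 m-?r      = contradiction refl ≢0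
  regen-of ≢0 (m-◇̂ _)   = contradiction refl ≢0
  regen-of ≢0 m-fix     = contradiction refl ≢0
  regen-of ≢0 m-∧l      = contradiction refl ≢0
  regen-of ≢0 m-∧r      = contradiction refl ≢0
  regen-of ≢0 (m-⇒ _)   = contradiction refl ≢0
  regen-of ≢0 (m-□ _ _) = contradiction refl ≢0
  regen-of ≢0 (m-◇ _)   = contradiction refl ≢0

  weight : Position → ℕ
  weight (pos _ ψ _)    = size ψ
  weight (◇pos _ ψ _)   = suc (size ψ)
  weight (?pos _ ψ θ _) = suc (size ψ + size θ)

  -- Without regeneration every move descends in the formula, auxiliary positions using up the extra
  -- unit of `size`. Hence 0 cannot be the greatest recurring priority.
  weight-< : ∀ {p p′} → Move p p′ → prio p ≡ 0 → weight p′ < weight p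
  weight-< m-∨l      _ = s≤s (m≤m+n _ _)
  weight-< m-∨r      _ = s≤s (m≤n+m _ _)
  weight-< m-?l      _ = s≤s (m≤m+n _ _)
  weight-< m-?r      _ = s≤s (m≤n+m _ _)
  weight-< (m-◇̂ _)   _ = ≤-refl
  weight-< m-fix     _ = ≤-refl
  weight-< m@(m-X _) e = case trans (sym e) (proj₂ (prio-regen m regen)) of λ ()
  weight-< m-∧l      _ = s≤s (m≤m+n _ _)
  weight-< m-∧r      _ = s≤s (m≤n+m _ _)
  weight-< (m-⇒ _)   _ = ≤-refl
  weight-< (m-□ _ _) _ = ≤-refl
  weight-< (m-◇ _)   _ = ≤-refl

  -- Leaving the subformulas of F takes the regeneration of a formula strictly
  -- above F, which is larger and so has a greater priority.
  Sub-move : ∀ {F p p′} → Move p p′ → Sub F φ → prio p ≤ fixPrio F →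
    Sub (formula p) F → Sub (formula p′) F
  Sub-move m-∨l      _ _ s = Sub-trans (∨l here) s
  Sub-move m-∨r      _ _ s = Sub-trans (∨r here) s
  Sub-move m-?l      _ _ s = Sub-trans (⇒l here) s
  Sub-move m-?r      _ _ s = Sub-trans (⇒r here) s
  Sub-move (m-◇̂ _)   _ _ s = Sub-trans (◇s here) s
  Sub-move m-fix     _ _ s = Sub-trans (fixs here) s
  Sub-move m-∧l      _ _ s = Sub-trans (∧l here) s
  Sub-move m-∧r      _ _ s = Sub-trans (∧r here) s
  Sub-move (m-⇒ _)   _ _ s = s
  Sub-move (m-□ _ _) _ _ s = Sub-trans (□s here) s
  Sub-move (m-◇ _)   _ _ s = s
  Sub-move {F} m@(m-X t) sF le s with binder-comparable sentence unique sF s t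
  ... | inj₁ below = below
  ... | inj₂ above = subst (Sub _) (sym (Sub-size-≡ above size≤)) here
    where
    size≤ = code-cancel-≤ _ (formulaOwner F) (subst (_≤ fixPrio F) (proj₂ (prio-regen m regen)) le)

  -- A move at priority 0 is covered by `Sub-move` with `φ` itself as the bound; any other move
  -- regenerates a subformula of `φ`.
  Sub-move-φ : ∀ {p p′} → Move p p′ → Sub (formula p) φ → Sub (formula p′) φ
  Sub-move-φ {p} m s with prio p ≟ 0
  ... | yes ≡0 = Sub-move m here (subst (_≤ fixPrio φ) (sym ≡0) z≤n) s
  ... | no ≢0 with regen-of ≢0 m
  ...   | _ , regen = proj₁ (prio-regen m regen)

  open ParityGame em Move owner prio codeWinner

  -- The greatest recurring priority and the outermost formula

  N₀ : ℕ
  N₀ = code (suc (size φ)) I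

  -- Once priorities stay at most `k`, a visit to `k` regenerates some `F`, and the play never
  -- leaves the subformulas of `F` again. Later regenerations thus lie in `F`, and those of priority
  -- `k` are of `F` itself.
  Wins⇒outermost : ∀ pl {f} → (∀ n → Move (f n) (f (suc n))) → Wins pl f →
    ∃ λ F → Outermost w F f × formulaOwner F ≡ pl
  Wins⇒outermost pl {f} moves (k , wk , inf , N , ev) = outer (regen-of (prio≢0 prio-i₀) (moves i₀))
    where
    i₀ = proj₁ (inf N) + N

    prio-i₀ : prio (f i₀) ≡ k
    prio-i₀ = proj₂ (inf N)

    -- If `k` were 0, every move from `N` on would lower the weight; this is impossible for one move
    -- more than `weight (f N)`.
    k≢0 : k ≢ 0
    k≢0 k≡0 = 1+n≰n (≤-trans (m≤n+m _ _) (descent (suc (weight (f N)))))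
      where
      descent : ∀ i → weight (f (i + N)) + i ≤ weight (f N)
      descent zero = ≤-reflexive (+-identityʳ _)
      descent (suc i) = begin
        weight (f (suc i + N)) + suc i ≡⟨ +-suc _ i ⟩
        suc (weight (f (suc i + N))) + i
          ≤⟨ +-monoˡ-≤ i (weight-< (moves (i + N)) (n≤0⇒n≡0 (subst (_ ≤_) k≡0 (ev i)))) ⟩
        weight (f (i + N)) + i ≤⟨ descent i ⟩
        weight (f N) ∎
        where open ≤-Reasoning

    prio≢0 : ∀ {m} → prio (f m) ≡ k → prio (f m) ≢ 0
    prio≢0 e e₀ = k≢0 (trans (sym e) e₀)

    outer : (∃ λ F → Regen w F (f i₀) (f (suc i₀))) →
      ∃ λ F → Outermost w F f × formulaOwner F ≡ pl
    outer (F , rg) = F , (F-inf , below) , F-owner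
      where
      sF : Sub F φ
      sF = proj₁ (prio-regen (moves i₀) rg)

      k≡ : k ≡ fixPrio F
      k≡ = trans (sym prio-i₀) (proj₂ (prio-regen (moves i₀) rg))

      F-owner : formulaOwner F ≡ pl
      F-owner = trans (sym (codeWinner-code (size F) _)) (trans (cong codeWinner (sym k≡)) wk)

      regen-formula : ∀ {G p p′} → Regen w G p p′ → formula p′ ≡ G
      regen-formula regen = refl

      prio≤ : ∀ {m} → N ≤ m → prio (f m) ≤ fixPrio F
      prio≤ {m} N≤m = subst₂ (λ i j → prio (f i) ≤ j) (m∸n+n≡m N≤m) k≡ (ev (m ∸ N))

      stays : ∀ j → Sub (formula (f (j + suc i₀))) F
      stays zero = subst (λ G → Sub G F) (sym (regen-formula rg)) here
      stays (suc j) = Sub-move (moves (j + suc i₀)) sF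
        (prio≤ (m≤n⇒m≤o+n j (m≤n⇒m≤1+n (m≤n+m N _)))) (stays j)

      regen-below : ∀ {G m} → suc i₀ ≤ m → Regen w G (f m) (f (suc m)) → Sub G F
      regen-below {G} {m} le rg′ = subst₂ (λ i H → Sub H F) {x = m} refl (regen-formula rg′)
        (subst (λ i → Sub (formula (f i)) F) (cong suc (m∸n+n≡m le)) (stays (suc (m ∸ suc i₀))))

      below : ∀ G → InfOften w G f → Sub G F
      below G G-inf with G-inf (suc i₀)
      ... | m , le , rg′ = regen-below le rg′

      F-inf : InfOften w F f
      F-inf n with inf (n + suc i₀)
      ... | i , e with regen-of (prio≢0 e) (moves (i + (n + suc i₀)))
      ...   | G , rg′ = m , m≤n⇒m≤o+n i (m≤m+n n _) ,
                subst (λ H → Regen w H (f m) (f (suc m))) G≡F rg′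
        where
        m = i + (n + suc i₀)

        G≡F : G ≡ F
        -- Equal priorities give equal sizes, and a subformula of full size is the whole formula.
        G≡F = Sub-size-≡ (regen-below (m≤n⇒m≤o+n i (m≤n+m (suc i₀) n)) rg′)
          (code-cancel-≤ _ (formulaOwner G)
            (≤-reflexive (trans (sym k≡) (trans (sym e) (proj₂ (prio-regen (moves m) rg′))))))

  Wins⇒WinsInfinite : ∀ pl {f} → (∀ n → Move (f n) (f (suc n))) → Wins pl f → WinsInfinite w pl f
  Wins⇒WinsInfinite I moves win with Wins⇒outermost I moves win
  ... | F , out , o = F , out , formulaOwner-I o
  -- An outermost formula is unique by antisymmetry, so one that made `I` win would be the `F` owned
  -- by `II`.
  Wins⇒WinsInfinite II moves win (G , (G-inf , G-max) , oG) with Wins⇒outermost II moves win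
  ... | F , (F-inf , F-max) , o = formulaOwner-II o
        (subst (OwnedByI w) (Sub-antisym (F-max G G-inf) (G-max F F-inf)) oG)

  -- Each position has exactly one owner

  role-exclusive : ∀ {p} → RoleOf p Vr → ¬ RoleOf p Rr
  role-exclusive (r-propV ¬v) (r-propR v) = ¬v v
  role-exclusive (r-⊥V ¬v) (r-⊥R v) = ¬v v
  role-exclusive (r-Xμ (_ , s)) (r-Xν (_ , t)) = case binder-unique φ unique s t of λ ()

  Owner-exclusive : ∀ p → Owner p I → ¬ Owner p II
  Owner-exclusive p oI oII with roleI p
  ... | Vr = role-exclusive oI oII
  ... | Rr = role-exclusive oII oI

  role-total : ∀ p → Sub (formula p) φ → ∃ (RoleOf p)
  role-total (pos v (prop P) Q) _ with em {P = V P v}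
  ... | yes x = Rr , r-propR x
  ... | no ¬x = Vr , r-propV ¬x
  role-total (pos v ⊥f Q) _ with em {P = W⊥ v}
  ... | yes x = Rr , r-⊥R x
  ... | no ¬x = Vr , r-⊥V ¬x
  role-total (pos v (var X) Q) s with bound sentence unique (even , occ-var) s
  ... | μ , a , t , _ = Vr , r-Xμ (a , t)
  ... | ν , a , t , _ = Rr , r-Xν (a , t)
  role-total (pos _ (_ ∧f _) _) _    = Rr , r-∧
  role-total (pos _ (_ ∨f _) _) _    = Vr , r-∨
  role-total (pos _ (_ ⇒f _) _) _    = Rr , r-⇒
  role-total (pos _ (□f _) _) _      = Rr , r-□
  role-total (pos _ (◇f _) _) _      = Rr , r-◇
  role-total (pos _ (fix μ _ _) _) _ = Vr , r-μ
  role-total (pos _ (fix ν _ _) _) _ = Rr , r-ν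
  role-total (◇pos _ _ _) _          = Vr , r-◇̂
  role-total (?pos _ _ _ _) _        = Vr , r-?

  Owner-total : ∀ p → Sub (formula p) φ → Owner p I ⊎ Owner p II
  Owner-total p s with role-total p s | roleI p
  ... | Vr , r | Vr = inj₁ r
  ... | Vr , r | Rr = inj₂ r
  ... | Rr , r | Vr = inj₂ r
  ... | Rr , r | Rr = inj₁ r

  Owner-owner : ∀ p → Sub (formula p) φ → Owner p (owner p)
  Owner-owner p s with em {P = Owner p I} | Owner-total p s
  ... | yes o | _      = o
  ... | no ¬o | inj₁ o = contradiction o ¬o
  ... | no _  | inj₂ o = o

  owner≡⇒Owner : ∀ {p pl} → Sub (formula p) φ → owner p ≡ pl → Owner p pl
  owner≡⇒Owner {p} s e = subst (Owner p) e (Owner-owner p s)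

  -- From winning regions to positional strategies

  WinRegion⇒winning : ∀ pl → WinRegion N₀ prio-bound pl (start w) →
    HasPositionalWinningStrategy w pl
  WinRegion⇒winning pl win = σ , (λ p _ → strategy-move N₀ prio-bound pl p) , finite , infinite
    where
    σ = strategy N₀ prio-bound pl

    -- The subformula part makes `owner` agree with `Owner` along the run, so that following `σ` in
    -- the game is following it in the parity game.
    Inv : Position → Set
    Inv p = Sub (formula p) φ × WinRegion N₀ prio-bound pl p

    Inv-start : ∀ {p} → p ≡ start w → Inv p
    Inv-start refl = here , win

    follows : ∀ {p p′} → Sub (formula p) φ → (Owner p pl → p′ ≡ σ p) → owner p ≡ pl → p′ ≡ σ p
    follows s fol e = fol (owner≡⇒Owner s e)

    Inv-step : ∀ {p p′} → Inv p → Move p p′ → (Owner p pl → p′ ≡ σ p) → Inv p′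
    Inv-step (s , r) m fol = Sub-move-φ m s , follow-stay N₀ prio-bound pl r m (follows s fol)

    finite : ∀ f k → IsFiniteRun w f k → Follows w pl σ f k → WinsFinite w pl f k
    finite f k (st , moves , stuck) fol with inv k ≤-refl
      where
      inv : ∀ n → n ≤ k → Inv (f n)
      inv zero _ = Inv-start st
      inv (suc n) n<k = Inv-step (inv n (<⇒≤ n<k)) (moves n n<k) (fol n n<k)
    ... | s , r = owner≡⇒Owner s (stuck-owner N₀ prio-bound pl r stuck)

    infinite : ∀ f → IsInfiniteRun w f → FollowsInf w pl σ f → WinsInfinite w pl f
    infinite f (st , moves) fol = Wins⇒WinsInfinite pl moves
      (follow-wins N₀ prio-bound pl (proj₂ (inv 0)) moves (λ i → follows (proj₁ (inv i)) (fol i)))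
      where
      inv : ∀ n → Inv (f n)
      inv zero = Inv-start st
      inv (suc n) = Inv-step (inv n) (moves n) (fol n)

  -- The two strategies are played against each other, and the resulting run would be won by both
  -- players.
  not-both : ¬ (HasPositionalWinningStrategy w I × HasPositionalWinningStrategy w II)
  not-both ((σ , σ-move , σ-fin , σ-inf) , (τ , τ-move , τ-fin , τ-inf)) = absurd
    where
    next : Position → Position
    next p with em {P = Owner p I}
    ... | yes _ = σ p
    ... | no _  = τ p

    next-I : ∀ {p} → Owner p I → next p ≡ σ p
    next-I {p} o with em {P = Owner p I}
    ... | yes _ = refl
    ... | no ¬o = contradiction o ¬o

    next-II : ∀ {p} → Owner p II → next p ≡ τ p
    next-II {p} o with em {P = Owner p I}
    ... | yes o′ = contradiction o (Owner-exclusive p o′)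
    ... | no _ = refl

    next-move : ∀ {p} → Sub (formula p) φ → HasMove p → Move p (next p)
    next-move {p} s hm with Owner-total p s
    ... | inj₁ o = subst (Move p) (sym (next-I o)) (σ-move p o hm)
    ... | inj₂ o = subst (Move p) (sym (next-II o)) (τ-move p o hm)

    run : ℕ → Position
    run zero    = start w
    run (suc n) = next (run n)

    moves-until : ∀ k → (∀ n → n < k → HasMove (run n)) → ∀ n → n < k → Move (run n) (run (suc n))
    moves-until k hm n n<k = next-move (sub n (<⇒≤ n<k)) (hm n n<k)
      where
      sub : ∀ n → n ≤ k → Sub (formula (run n)) φ
      sub zero    _   = here
      sub (suc n) n<k = Sub-move-φ (next-move (sub n (<⇒≤ n<k)) (hm n n<k)) (sub n (<⇒≤ n<k))

    never-stuck : ∀ k → HasMove (run k)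
    -- A run stuck for the first time at `k` is a finite run following both strategies, so each of
    -- them assigns the last position to the other player.
    never-stuck = <-rec _ λ k hm → decidable-stable em λ stuck →
      let fin = refl , moves-until k (λ n n<k → hm n<k) , stuck in
      Owner-exclusive (run k)
        (τ-fin run k fin (λ _ _ → next-II))
        (σ-fin run k fin (λ _ _ → next-I))

    absurd : _
    absurd = τ-inf run inf (λ _ → next-II) (σ-inf run inf (λ _ → next-I))
      where
      inf = refl , λ n → moves-until (suc n) (λ m _ → never-stuck m) n ≤-refl

  exactly-one : ExactlyOneWins M w φ
  exactly-one = (case determined N₀ prio-bound (start w) of λ where
      (inj₁ r) → inj₁ (WinRegion⇒winning I r)
      (inj₂ r) → inj₂ (WinRegion⇒winning II r)) , not-both

mainTheorem3 : ExcludedMiddle 0ℓ →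
    ∀ {Prop Var : Set} (M : CKModel Prop) (w : CKModel.W M) (φ : Fm Prop Var) →
    IsMuFormula φ → Sentence φ → WellNamed φ →
    ExactlyOneWins M w φ
mainTheorem3 em M w φ _ sentence (_ , unique) = Evaluation.exactly-one em M w φ sentence unique
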